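{- $\text{OWSP}_1(\rho_1,\dots,\rho_t)$ is fixed-parameter tractable (FPT) if $\text{WSP}_1(\rho_1,\dots,\rho_t)$ is, where in both problems the parameter is the number $k$ of steps.
   Context: A workflow specification is a directed acyclic graph $(S,E)$ on a set $S$ of steps; its reflexive transitive closure is a partial order $\leqslant$ on $S$ ($s\leqslant s'$ iff there is a path from $s$ to $s'$). A constrained workflow authorization schema is a tuple $((S,E),U,A,C)$, where $U$ is a set of users, $A\subseteq S\times U$ is an authorization policy (for every $s\in S$ there is some $u\in U$ with $(s,u)\in A$), and $C$ is a set of constraints. Here all constraints are of Type 1, i.e. of the form $(\rho,s,s')$ with $s,s'\in S$ and $\rho\subseteq U\times U$. A plan is a function $\pi:S\to U$; it is authorized if $(s,\pi(s))\in A$ for all $s\in S$. WSP: a plan $\pi$ satisfies $(\rho,s,s')$ if $(\pi(s),\pi(s'))\in\rho$; the problem is to find an authorized plan satisfying all constraints in $C$ or to answer that none exists. $\text{WSP}_1(\rho_1,\dots,\rho_t)$ is the special case in which every constraint has the form $(\rho_i,s,s')$ for some $\rho_i\in\{\rho_1,\dots,\rho_t\}$ and $s,s'\in S$. Ordered WSP (OWSP): an execution schedule is a tuple $(s_1,\dots,s_k)$ with $\{s_1,\dots,s_k\}=S$, $k=|S|$, and $s_i\not\geqslant s_j$ for all $1\leqslant i<j\leqslant k$ (a linear extension of $(S,\leqslant)$); $s_i$ precedes $s_j$ in the schedule if $i<j$. Constraints $(\rho,s,s')$ with $s>s'$ are not allowed. The constraint $(\rho,s,s')$ is satisfied by an execution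 schedule $\sigma$ and plan $\pi$ if either (i) $s$ precedes $s'$ in $\sigma$ and $(\pi(s),\pi(s'))\in\rho$, or (ii) $s'$ precedes $s$ in $\sigma$. OWSP asks whether there exist an execution schedule $\sigma$ and an authorized plan $\pi$ that satisfy all constraints in $C$. $\text{OWSP}_1(\rho_1,\dots,\rho_t)$ is OWSP restricted to instances in which every constraint has the form $(\rho_i,s,s')$ for some $\rho_i\in\{\rho_1,\dots,\rho_t\}$ and $s,s'\in S$. A problem with parameter $k$ is FPT if it can be solved by an algorithm running in time $O(f(k)N^d)$, where $N$ is the size of the input, $f$ is a function of $k$ only, and $d$ is a constant independent of $k$ and $N$. -}

module Defs where

open import Data.Bool.Base using (Bool; true; false; T)
open import Data.Fin.Base using (Fin; toℕ) renaming (_<_ to _<ᶠ_)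
open import Data.List.Base using (List; []; _∷_; map; tabulate)
open import Data.List.Relation.Unary.All using (All)
open import Data.Nat.Base using (ℕ; zero; suc; _+_; _*_; _^_; _≤_)
open import Data.Product.Base using (Σ-syntax; ∃-syntax; _×_)
open import Data.Sum.Base using (_⊎_)
open import Function.Definitions using (StrictlySurjective)
open import Relation.Binary.Construct.Closure.ReflexiveTransitive using (Star)
open import Relation.Binary.Construct.Closure.Transitive using (TransClosure)
open import Relation.Binary.PropositionalEquality.Core using (_≡_; _≢_)
open import Relation.Nullary.Negation.Core using (¬_)

------------------------------------------------------------------------
-- Machine model
--
-- Programs compute on binary trees, as in N. D. Jones's WHILE language
-- ("Computability and Complexity from a Programming Perspective"), here
-- in point-free form: a program is a partial function from trees to
-- trees.  Trees are thought of as pointers to shared immutable cells, so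
-- every construct does a constant amount of work besides running its
-- parts, and running time agrees with that of Turing machines up to a
-- polynomial.  There is no primitive comparison of trees.

infixr 5 _∙_

data Tree : Set where
  nil : Tree
  _∙_ : Tree → Tree → Tree

size : Tree → ℕ
size nil     = 1
size (l ∙ r) = suc (size l + size r)

leftOf rightOf : Tree → Tree
leftOf nil      = nil
leftOf (l ∙ r)  = l
rightOf nil     = nil
rightOf (l ∙ r) = r

infixr 4 _⨾_

data Program : Set where
  self empty left right : Program
  ⟨_,_⟩ : Program → Program → Program
  _⨾_   : Program → Program → Program
  cond  : Program → Program → Program → Program
  while : Program → Program → Program

-- p ⊢ x ⇓ y [ c ]: on input x, program p halts with output y after c
-- steps.  Tests read nil as false and every other tree as true.

infix 3 _⊢_⇓_[_]

data _⊢_⇓_[_] : Program → Tree → Tree → ℕ → Set where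

  ⇓-self  : ∀ {x} → self ⊢ x ⇓ x [ 1 ]
  ⇓-empty : ∀ {x} → empty ⊢ x ⇓ nil [ 1 ]
  ⇓-left  : ∀ {x} → left ⊢ x ⇓ leftOf x [ 1 ]
  ⇓-right : ∀ {x} → right ⊢ x ⇓ rightOf x [ 1 ]

  ⇓-pair : ∀ {p q x y z a b} →
    p ⊢ x ⇓ y [ a ] → q ⊢ x ⇓ z [ b ] →
    ⟨ p , q ⟩ ⊢ x ⇓ y ∙ z [ suc (a + b) ]

  ⇓-seq : ∀ {p q x y z a b} →
    p ⊢ x ⇓ y [ a ] → q ⊢ y ⇓ z [ b ] →
    p ⨾ q ⊢ x ⇓ z [ suc (a + b) ]

  ⇓-then : ∀ {p q r x l m y a b} →
    p ⊢ x ⇓ l ∙ m [ a ] → q ⊢ x ⇓ y [ b ] →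
    cond p q r ⊢ x ⇓ y [ suc (a + b) ]

  ⇓-else : ∀ {p q r x y a b} →
    p ⊢ x ⇓ nil [ a ] → r ⊢ x ⇓ y [ b ] →
    cond p q r ⊢ x ⇓ y [ suc (a + b) ]

  ⇓-stop : ∀ {p q x a} →
    p ⊢ x ⇓ nil [ a ] →
    while p q ⊢ x ⇓ x [ suc a ]

  ⇓-loop : ∀ {p q x l m y z a b c} →
    p ⊢ x ⇓ l ∙ m [ a ] → q ⊢ x ⇓ y [ b ] → while p q ⊢ y ⇓ z [ c ] →
    while p q ⊢ x ⇓ z [ suc (a + b + c) ]

------------------------------------------------------------------------
-- Parameterized problems

-- Correct I y says that y is an acceptable output on instance I, which
-- covers both decision and search problems.

record ParamProblem : Set₁ where
  field
    Instance  : Set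
    encode    : Instance → Tree
    parameter : Instance → ℕ
    Correct   : Instance → Tree → Set

-- The constant hidden in O(f(k) N^d) is absorbed by f; every size is at
-- least 1.

FPT : ParamProblem → Set
FPT P =
  Σ[ p ∈ Program ] Σ[ f ∈ (ℕ → ℕ) ] Σ[ d ∈ ℕ ]
  ((I : Instance) →
    ∃[ y ] ∃[ c ]
      (p ⊢ encode I ⇓ y [ c ])
      × c ≤ f (parameter I) * size (encode I) ^ d
      × Correct I y)
  where open ParamProblem P

------------------------------------------------------------------------
-- Encodings

encBool : Bool → Tree
encBool false = nil
encBool true  = nil ∙ nil

encℕ : ℕ → Tree
encℕ zero    = nil
encℕ (suc n) = nil ∙ encℕ n

encFin : ∀ {n} → Fin n → Tree
encFin i = encℕ (toℕ i)

encList : List Tree → Tree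
encList []       = nil
encList (x ∷ xs) = x ∙ encList xs

encMatrix : ∀ {m n} → (Fin m → Fin n → Bool) → Tree
encMatrix M = encList (tabulate λ i → encList (tabulate λ j → encBool (M i j)))

------------------------------------------------------------------------
-- Constrained workflow authorization schemas with Type 1 constraints

UserRel : ℕ → Set
UserRel n = Fin n → Fin n → Bool

record Constraint (k n : ℕ) : Set where
  constructor constraint
  field
    rel    : UserRel n
    source : Fin k
    target : Fin k

-- Steps are Fin k and users are Fin n; finite relations are given by
-- their Boolean matrices.

record Schema (k n : ℕ) : Set where
  field
    E : Fin k → Fin k → Bool
    A : Fin k → Fin n → Bool
    C : List (Constraint k n)

  Edge : Fin k → Fin k → Set
  Edge s s′ = T (E s s′)

  infix 4 _≼_ _≺_

  _≼_ : Fin k → Fin k → Set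
  _≼_ = Star Edge

  _≺_ : Fin k → Fin k → Set
  s ≺ s′ = s ≼ s′ × s ≢ s′

  field
    acyclic    : ∀ s → ¬ TransClosure Edge s s
    authorized : ∀ s → ∃[ u ] T (A s u)

  Plan : Set
  Plan = Fin k → Fin n

  Authorized : Plan → Set
  Authorized π = ∀ s → T (A s (π s))

  encodePlan : Plan → Tree
  encodePlan π = encList (tabulate λ s → encFin (π s))

  record Schedule : Set where
    field
      step       : Fin k → Fin k
      exhaustive : StrictlySurjective _≡_ step
      extension  : ∀ i j → i <ᶠ j → ¬ (step j ≼ step i)

    Precedes : Fin k → Fin k → Set
    Precedes s s′ = ∃[ i ] ∃[ j ] step i ≡ s × step j ≡ s′ × i <ᶠ j

encConstraint : ∀ {k n} → Constraint k n → Tree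
encConstraint c = encMatrix rel ∙ encFin source ∙ encFin target
  where open Constraint c

encSchema : ∀ {k n} → Schema k n → Tree
encSchema {k} {n} W =
  encℕ k ∙ encMatrix E ∙ encℕ n ∙ encMatrix A ∙ encList (map encConstraint C)
  where open Schema W

------------------------------------------------------------------------
-- WSP and OWSP restricted to the relations ρ₁, …, ρₜ

-- The user set varies with the instance, so ρ₁, …, ρₜ are t relation
-- symbols together with the tuples of relations they may denote on n
-- users.  This covers symbols with a unique meaning on each user set,
-- such as = and ≠, as well as, say, an arbitrary equivalence ∼ and its
-- complement.

Relations : ℕ → Set₁
Relations t = (n : ℕ) → (Fin t → UserRel n) → Set

RestrictedTo : ∀ {t k n} → Relations t → Schema k n → Set
RestrictedTo {t} {n = n} 𝓡 W =
  Σ[ ρ ∈ (Fin t → UserRel n) ]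
    𝓡 n ρ × All (λ c → ∃[ i ] (∀ u v → Constraint.rel c u v ≡ ρ i u v)) C
  where open Schema W

record WSPInstance {t} (𝓡 : Relations t) : Set where
  field
    steps users : ℕ
    schema      : Schema steps users
    restricted  : RestrictedTo 𝓡 schema
  open Schema schema public

  Satisfies : Plan → Constraint steps users → Set
  Satisfies π (constraint ρ s s′) = T (ρ (π s) (π s′))

  Solution : Plan → Set
  Solution π = Authorized π × All (Satisfies π) C

record OWSPInstance {t} (𝓡 : Relations t) : Set where
  field
    steps users : ℕ
    schema      : Schema steps users
    restricted  : RestrictedTo 𝓡 schema
  open Schema schema public
  field
    -- no constraint (ρ , s , s′) with s > s′
    forward : All (λ c → ¬ (Constraint.target c ≺ Constraint.source c)) C

  Satisfies : Schedule → Plan → Constraint steps users → Set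
  Satisfies σ π (constraint ρ s s′) =
    (Precedes s s′ × T (ρ (π s) (π s′))) ⊎ Precedes s′ s
    where open Schedule σ

  Solution : Schedule → Plan → Set
  Solution σ π = Authorized π × All (Satisfies σ π) C

-- Search problem: return a solution, tagged to differ from nil, or nil
-- if there is none.

WSP₁ : ∀ {t} → Relations t → ParamProblem
WSP₁ 𝓡 = record
  { Instance  = WSPInstance 𝓡
  ; encode    = λ I → encSchema (schema I)
  ; parameter = steps
  ; Correct   = λ I y →
      (∃[ π ] Solution I π × y ≡ nil ∙ encodePlan I π)
      ⊎ (¬ (∃[ π ] Solution I π) × y ≡ nil)
  }
  where open WSPInstance

-- Decision problem.

OWSP₁ : ∀ {t} → Relations t → ParamProblem
OWSP₁ 𝓡 = record
  { Instance  = OWSPInstance 𝓡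
  ; encode    = λ I → encSchema (schema I)
  ; parameter = steps
  ; Correct   = λ I y →
      ((∃[ σ ] ∃[ π ] Solution I σ π) × y ≡ encBool true)
      ⊎ (¬ (∃[ σ ] ∃[ π ] Solution I σ π) × y ≡ encBool false)
  }
  where open OWSPInstance

{-# OPTIONS --safe #-}

-- A solvable OWSP instance is one in which some assignment of positions to
-- the steps increases along every edge, separates the two steps of every
-- constraint, and makes the constraints (ρ , s , s′) with s placed before s′
-- solvable as a WSP instance: the positions in a schedule form such an
-- assignment, and conversely sorting the steps by position gives a schedule.
-- So it suffices to try all assignments, calling the WSP algorithm for each.
-- Any tree can be read as an assignment, and all assignments of positions below k
-- occur among the trees of height at most 2k, whose number depends
-- on k alone.  Likewise any cost that depends only on a tree whose height is
-- bounded in k is bounded by a function of k, so only the loop over the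
-- constraints and the calls to the WSP algorithm have to be counted.

module Submission where

open import Data.Bool.Base using (Bool; true; false; T)
open import Data.Fin.Base using (Fin; zero; suc; toℕ; fromℕ; inject₁; cast)
  renaming (_<_ to _<ᶠ_)
open import Data.Fin.Properties using (toℕ<n; toℕ-cast; cast-involutive; toℕ-fromℕ; toℕ-inject₁)
  renaming (<-cmp to <ᶠ-cmp)
open import Data.Fin.Relation.Unary.Top using (view; ‵fromℕ; ‵inject₁)
open import Data.List.Base
  using (List; []; _∷_; _++_; length; map; filter; tabulate; lookup; allFin; downFrom;
         cartesianProductWith)
open import Data.List.Membership.Propositional using (_∈_; find; lose)
open import Data.List.Membership.Propositional.Properties
  using (∈-map⁺; ∈-filter⁺; ∈-filter⁻; ∈-lookup; ∈-allFin;
         ∈-cartesianProductWith⁺; ∈-cartesianProductWith⁻)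
open import Data.List.Properties using (map-∘; map-cong; map-id; length-filter; length-tabulate)
open import Data.List.Relation.Binary.Permutation.Propositional using (↭⇒↭ₛ; ↭-sym)
open import Data.List.Relation.Binary.Permutation.Propositional.Properties
  using (↭-length; ∈-resp-↭)
open import Data.List.Relation.Binary.Permutation.Setoid.Properties using (Unique-resp-↭)
open import Data.List.Relation.Unary.All as All using (All; []; _∷_)
import Data.List.Relation.Unary.All.Properties as All
open import Data.List.Relation.Unary.AllPairs using (AllPairs; _∷_)
open import Data.List.Relation.Unary.Any using (Any; here; there; index)
open import Data.List.Relation.Unary.Any.Properties using (lookup-index)
open import Data.List.Relation.Unary.Sorted.TotalOrder.Properties using (lookup-mono-≤)
open import Data.List.Relation.Unary.Unique.Propositional using (Unique)
open import Data.List.Relation.Unary.Unique.Propositional.Properties using (allFin⁺)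
import Data.List.Sort as Sort
open import Data.Nat.Base
open import Data.Nat.ListAction using (sum)
open import Data.Nat.Properties
open import Data.Nat.Tactic.RingSolver using (solve-∀)
open import Data.Product.Base using (∃-syntax; _×_; _,_; proj₁; proj₂)
open import Data.Sum.Base using (_⊎_; inj₁; inj₂; [_,_]′)
open import Data.Unit.Base using (tt)
open import Function.Base using (_∘_; id)
open import Relation.Binary.Bundles using (DecTotalOrder)
open import Relation.Binary.Construct.Closure.ReflexiveTransitive using (ε; _◅_)
open import Relation.Binary.Construct.Closure.Transitive using ([_])
import Relation.Binary.Construct.On as On
open import Relation.Binary.Definitions using (tri<; tri≈; tri>)
open import Relation.Binary.PropositionalEquality
  using (_≡_; _≢_; refl; sym; trans; cong; cong₂; subst; subst₂; setoid; module ≡-Reasoning)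
open import Relation.Nullary using (¬_; Dec; yes; no; contradiction)
open import Relation.Unary using (Decidable)
open import Defs

-- Programs computing right folds

-- Fixed-parameter tractability asks only for upper bounds, so runs are tracked up to a bound that
-- can be weakened.
infix 3 _⊢_⇓_≤[_]

_⊢_⇓_≤[_] : Program → Tree → Tree → ℕ → Set
p ⊢ x ⇓ y ≤[ c ] = ∃[ c′ ] (p ⊢ x ⇓ y [ c′ ]) × c′ ≤ c

branch : Tree → Tree → Tree → Tree
branch nil     y z = z
branch (_ ∙ _) y z = y

pair-runs : ∀ {p q x y z a b} → p ⊢ x ⇓ y ≤[ a ] → q ⊢ x ⇓ z ≤[ b ] →
            ⟨ p , q ⟩ ⊢ x ⇓ y ∙ z ≤[ suc (a + b) ]
pair-runs (_ , d , a≤) (_ , e , b≤) = _ , ⇓-pair d e , s≤s (+-mono-≤ a≤ b≤)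

seq-runs : ∀ {p q x y z a b} → p ⊢ x ⇓ y ≤[ a ] → q ⊢ y ⇓ z ≤[ b ] →
           p ⨾ q ⊢ x ⇓ z ≤[ suc (a + b) ]
seq-runs (_ , d , a≤) (_ , e , b≤) = _ , ⇓-seq d e , s≤s (+-mono-≤ a≤ b≤)

-- The bound charges both branches, so it does not depend on the outcome of the test. The test comes
-- last in the sum, so that literal branch costs add up by reduction.
cond-runs : ∀ {p q r x t y z a b c} →
            p ⊢ x ⇓ t ≤[ a ] → q ⊢ x ⇓ y ≤[ b ] → r ⊢ x ⇓ z ≤[ c ] →
            cond p q r ⊢ x ⇓ branch t y z ≤[ suc (b + c + a) ]
cond-runs {t = nil} {a = a} {b} {c} (a′ , d , a≤) _ (c′ , e , c≤) =
  _ , ⇓-else d e , s≤s (begin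
    a′ + c′   ≤⟨ +-mono-≤ a≤ (≤-trans c≤ (m≤n+m c b)) ⟩
    a + (b + c) ≡⟨ +-comm a (b + c) ⟩
    b + c + a   ∎)
  where open ≤-Reasoning
cond-runs {t = _ ∙ _} {a = a} {b} {c} (a′ , d , a≤) (b′ , e , b≤) _ =
  _ , ⇓-then d e , s≤s (begin
    a′ + b′   ≤⟨ +-mono-≤ a≤ (≤-trans b≤ (m≤m+n b c)) ⟩
    a + (b + c) ≡⟨ +-comm a (b + c) ⟩
    b + c + a   ∎)
  where open ≤-Reasoning

weaken : ∀ {p x y a b} → a ≤ b → p ⊢ x ⇓ y ≤[ a ] → p ⊢ x ⇓ y ≤[ b ]
weaken a≤b (c , d , c≤a) = c , d , ≤-trans c≤a a≤b

foldrTree : (Tree → Tree → Tree) → Tree → Tree → Tree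
foldrTree g a nil     = a
foldrTree g a (h ∙ l) = g h (foldrTree g a l)

-- The 37 per item is 21 for moving one cell in `reverseLoop` plus 16 for one round of `foldLoop`
-- outside `q`.
foldrCost : (Tree → Tree → ℕ) → (Tree → Tree → Tree) → Tree → Tree → ℕ
foldrCost κ g a nil     = 0
foldrCost κ g a (h ∙ l) = 37 + κ h (foldrTree g a l) + foldrCost κ g a l

reverseLoop : Program
reverseLoop = while (left ⨾ left)
  ⟨ ⟨ left ⨾ left ⨾ right , left ⨾ right ⟩ , ⟨ left ⨾ left ⨾ left , right ⟩ ⟩

foldLoop : Program → Program
foldLoop q = while left
  ⟨ left ⨾ right , ⟨ right ⨾ left , ⟨ left ⨾ left , right ⟩ ⨾ q ⟩ ⟩

-- Applied to list ∙ environment ∙ initial value.  The loop consumes its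
-- list from the left, so a right fold reverses the list first.
foldrProgram : Program → Program
foldrProgram q =
  ⟨ self , empty ⟩ ⨾ reverseLoop ⨾ ⟨ right , left ⨾ right ⟩ ⨾ foldLoop q ⨾ right ⨾ right

revAppend : Tree → Tree → Tree
revAppend nil     r = r
revAppend (h ∙ l) r = revAppend l (h ∙ r)

reverseCost : Tree → ℕ
reverseCost nil     = 4
reverseCost (_ ∙ l) = 21 + reverseCost l

reverseLoop-runs : ∀ l e r → reverseLoop ⊢ (l ∙ e) ∙ r ⇓ (nil ∙ e) ∙ revAppend l r [ reverseCost l ]
reverseLoop-runs nil e r = ⇓-stop (⇓-seq ⇓-left ⇓-left)
reverseLoop-runs (h ∙ l) e r =
  ⇓-loop (⇓-seq ⇓-left ⇓-left)
    (⇓-pair (⇓-pair (⇓-seq ⇓-left (⇓-seq ⇓-left ⇓-right)) (⇓-seq ⇓-left ⇓-right))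
            (⇓-pair (⇓-seq ⇓-left (⇓-seq ⇓-left ⇓-left)) ⇓-right))
    (reverseLoop-runs l e (h ∙ r))

module _ {q : Program} {env : Tree} {g : Tree → Tree → Tree} {κ : Tree → Tree → ℕ}
         (runs : ∀ h acc → q ⊢ h ∙ env ∙ acc ⇓ g h acc ≤[ κ h acc ]) where

  foldLoop-step : ∀ {h l acc z c} →
    foldLoop q ⊢ l ∙ env ∙ g h acc ⇓ z ≤[ c ] →
    foldLoop q ⊢ (h ∙ l) ∙ env ∙ acc ⇓ z ≤[ 16 + (κ h acc + c) ]
  foldLoop-step {h} {l} {acc} (c′ , d , c′≤c) with (k , e , k≤) ← runs h acc =
    _ , ⇓-loop ⇓-left
          (⇓-pair (⇓-seq ⇓-left ⇓-right)
             (⇓-pair (⇓-seq ⇓-right ⇓-left)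
                (⇓-seq (⇓-pair (⇓-seq ⇓-left ⇓-left) ⇓-right) e))) d
      , +-monoʳ-≤ 16 (+-mono-≤ k≤ c′≤c)

  loopCost : Tree → Tree → ℕ
  loopCost a nil     = 0
  loopCost a (h ∙ l) = loopCost a l + (16 + κ h (foldrTree g a l))

  -- Taking the rest of the run on `r` as a premise makes induction on `l` possible: the head of `l`
  -- is the item of `l` that the loop meets last, just before `r`.
  foldLoop-runs : ∀ {a z c} l r →
    foldLoop q ⊢ r ∙ env ∙ foldrTree g a l ⇓ z ≤[ c ] →
    foldLoop q ⊢ revAppend l r ∙ env ∙ a ⇓ z ≤[ loopCost a l + c ]
  foldLoop-runs nil r d = d
  foldLoop-runs {a} {c = c} (h ∙ l) r d = weaken
    (≤-reflexive (sym (+-assoc (loopCost a l) (16 + κ h (foldrTree g a l)) c)))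
    (foldLoop-runs l (h ∙ r) (foldLoop-step d))

  reverse+loop : ∀ a l → reverseCost l + loopCost a l ≡ 4 + foldrCost κ g a l
  reverse+loop a nil = refl
  reverse+loop a (h ∙ l) = begin
    21 + r + (s + (16 + k))  ≡⟨ lemma r s k ⟩
    37 + k + (r + s)         ≡⟨ cong (37 + k +_) (reverse+loop a l) ⟩
    37 + k + (4 + f)         ≡⟨ +-comm-4 k f ⟩
    4 + (37 + k + f)         ∎
    where
    open ≡-Reasoning
    r = reverseCost l
    s = loopCost a l
    k = κ h (foldrTree g a l)
    f = foldrCost κ g a l
    lemma : ∀ r s k → 21 + r + (s + (16 + k)) ≡ 37 + k + (r + s)
    lemma = solve-∀
    +-comm-4 : ∀ k f → 37 + k + (4 + f) ≡ 4 + (37 + k + f)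
    +-comm-4 = solve-∀

  foldrProgram-runs : ∀ l a →
    foldrProgram q ⊢ l ∙ env ∙ a ⇓ foldrTree g a l ≤[ 21 + foldrCost κ g a l ]
  foldrProgram-runs l a = weaken (≤-reflexive cost-eq)
    (seq-runs (_ , ⇓-pair ⇓-self ⇓-empty , ≤-refl)
    (seq-runs (_ , reverseLoop-runs l (env ∙ a) nil , ≤-refl)
    (seq-runs (_ , ⇓-pair ⇓-right (⇓-seq ⇓-left ⇓-right) , ≤-refl)
    (seq-runs (foldLoop-runs l nil (_ , ⇓-stop ⇓-left , ≤-refl))
              (_ , ⇓-seq ⇓-right ⇓-right , ≤-refl)))))
    where
    -- The fixed overhead of 17: 3 and 5 for the two rearrangements, 2 for the last test of
    -- `foldLoop`, 3 for the final projection and 4 for the sequencings.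
    shuffle : ∀ r s → suc (3 + suc (r + suc (5 + suc ((s + 2) + 3)))) ≡ 17 + (r + s)
    shuffle = solve-∀
    cost-eq : _
    cost-eq = trans (shuffle (reverseCost l) (loopCost a l)) (cong (17 +_) (reverse+loop a l))

-- Total terms with right folds, and their compilation

infixr 4 _⨾_

-- With `foldr` in place of `while` every term terminates, so its value and a bound on its cost are
-- plain functions, defined by recursion on the term.
data Term : Set where
  self empty left right : Term
  ⟨_,_⟩ : Term → Term → Term
  _⨾_   : Term → Term → Term
  cond  : Term → Term → Term → Term
  foldr : Term → Term → Term → Term

-- In foldr list base step, the step is run on item ∙ input ∙ accumulator.
eval : Term → Tree → Tree
eval self           x = x
eval empty          x = nil
eval left           x = leftOf x
eval right          x = rightOf x
eval ⟨ s , t ⟩      x = eval s x ∙ eval t x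
eval (s ⨾ t)        x = eval t (eval s x)
eval (cond s t u)   x = branch (eval s x) (eval t x) (eval u x)
eval (foldr l a t)  x = foldrTree (λ h acc → eval t (h ∙ x ∙ acc)) (eval a x) (eval l x)

-- An upper bound only: a cond is charged for both branches.
cost : Term → Tree → ℕ
cost self          x = 1
cost empty         x = 1
cost left          x = 1
cost right         x = 1
cost ⟨ s , t ⟩     x = suc (cost s x + cost t x)
cost (s ⨾ t)       x = suc (cost s x + cost t (eval s x))
cost (cond s t u)  x = suc (cost t x + cost u x + cost s x)
cost (foldr l a t) x =
  suc (suc (cost l x + suc (1 + cost a x)) +
       (21 + foldrCost (λ h acc → cost t (h ∙ x ∙ acc)) (λ h acc → eval t (h ∙ x ∙ acc))
                       (eval a x) (eval l x)))

compile : Term → Program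
compile self          = self
compile empty         = empty
compile left          = left
compile right         = right
compile ⟨ s , t ⟩     = ⟨ compile s , compile t ⟩
compile (s ⨾ t)       = compile s ⨾ compile t
compile (cond s t u)  = cond (compile s) (compile t) (compile u)
compile (foldr l a t) = ⟨ compile l , ⟨ self , compile a ⟩ ⟩ ⨾ foldrProgram (compile t)

compile-runs : ∀ t x → compile t ⊢ x ⇓ eval t x ≤[ cost t x ]
compile-runs self          x = _ , ⇓-self , ≤-refl
compile-runs empty         x = _ , ⇓-empty , ≤-refl
compile-runs left          x = _ , ⇓-left , ≤-refl
compile-runs right         x = _ , ⇓-right , ≤-refl
compile-runs ⟨ s , t ⟩     x = pair-runs (compile-runs s x) (compile-runs t x)
compile-runs (s ⨾ t)       x = seq-runs (compile-runs s x) (compile-runs t (eval s x))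
compile-runs (cond s t u)  x =
  cond-runs (compile-runs s x) (compile-runs t x) (compile-runs u x)
compile-runs (foldr l a t) x =
  seq-runs (pair-runs (compile-runs l x) (pair-runs (_ , ⇓-self , ≤-refl) (compile-runs a x)))
           (foldrProgram-runs (λ h acc → compile-runs t (h ∙ x ∙ acc)) (eval l x) (eval a x))

-- Trees of bounded height and total programs on trees

height : Tree → ℕ
height nil     = 0
height (l ∙ r) = suc (height l ⊔ height r)

treesUpTo : ℕ → List Tree
treesUpTo zero    = nil ∷ []
treesUpTo (suc n) = nil ∷ cartesianProductWith _∙_ (treesUpTo n) (treesUpTo n)

∈-treesUpTo : ∀ {n} x → height x ≤ n → x ∈ treesUpTo n
∈-treesUpTo {zero}  nil     _         = here refl
∈-treesUpTo {suc n} nil     _         = here refl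
∈-treesUpTo {suc n} (l ∙ r) (s≤s h≤n) = there (∈-cartesianProductWith⁺ _∙_
  (∈-treesUpTo l (≤-trans (m≤m⊔n (height l) (height r)) h≤n))
  (∈-treesUpTo r (≤-trans (m≤n⊔m (height l) (height r)) h≤n)))

∈-treesUpTo⁻ : ∀ n {x} → x ∈ treesUpTo n → height x ≤ n
∈-treesUpTo⁻ zero    (here refl) = z≤n
∈-treesUpTo⁻ (suc n) (here refl) = z≤n
∈-treesUpTo⁻ (suc n) (there x∈)
  with l , r , l∈ , r∈ , refl ← ∈-cartesianProductWith⁻ _∙_ (treesUpTo n) (treesUpTo n) x∈ =
  s≤s (⊔-lub (∈-treesUpTo⁻ n l∈) (∈-treesUpTo⁻ n r∈))

∈⇒≤sum : ∀ {A : Set} (f : A → ℕ) {x xs} → x ∈ xs → f x ≤ sum (map f xs)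
∈⇒≤sum f (here refl)              = m≤m+n _ _
∈⇒≤sum f {xs = y ∷ _} (there x∈) = ≤-trans (∈⇒≤sum f x∈) (m≤n+m _ (f y))

-- A sum over finitely many trees dominates each of its summands, so it serves as a bound for any
-- `f`, with no analysis of how `f` grows.
boundUpTo : (Tree → ℕ) → ℕ → ℕ
boundUpTo f n = sum (map f (treesUpTo n))

≤-boundUpTo : ∀ f {n} x → height x ≤ n → f x ≤ boundUpTo f n
≤-boundUpTo f x h≤n = ∈⇒≤sum f (∈-treesUpTo x h≤n)

height-encℕ : ∀ n → height (encℕ n) ≡ n
height-encℕ zero    = refl
height-encℕ (suc n) = cong suc (height-encℕ n)

height-encFin : ∀ {n} (i : Fin n) → height (encFin i) ≤ n
height-encFin i = ≤-trans (≤-reflexive (height-encℕ (toℕ i))) (<⇒≤ (toℕ<n i))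

height-encBool : ∀ b → height (encBool b) ≤ 1
height-encBool false = z≤n
height-encBool true  = s≤s z≤n

height-tabulate : ∀ {n b} (f : Fin n → Tree) → (∀ i → height (f i) ≤ b) →
                  height (encList (tabulate f)) ≤ n + b
height-tabulate {zero}  f f≤b = z≤n
height-tabulate {suc n} {b} f f≤b = s≤s (⊔-lub
  (≤-trans (f≤b zero) (m≤n+m b n)) (height-tabulate (f ∘ suc) (f≤b ∘ suc)))

height-encMatrix : ∀ {m n} (M : Fin m → Fin n → Bool) → height (encMatrix M) ≤ m + (n + 1)
height-encMatrix M = height-tabulate _ λ i → height-tabulate _ λ j → height-encBool (M i j)

-- Terms for enumeration, comparison and lookup

item input acc truth : Term
item  = left
input = right ⨾ left
acc   = right ⨾ right
truth = ⟨ empty , empty ⟩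

infix 3 _Decides_

-- Truth is read as in `cond`, where any tree but `nil` is true. Since the output tree is an index,
-- matching on a decision also resolves the `branch` on it.
data Decision (P : Set) : Tree → Set where
  holds : ∀ {l r} → P → Decision P (l ∙ r)
  fails : ¬ P → Decision P nil

_Decides_ : Tree → Set → Set
y Decides P = Decision P y

decision : ∀ {y P} → y Decides P → Dec P
decision (holds p)  = yes p
decision (fails ¬p) = no ¬p

decides-map : ∀ {y P Q} → (P → Q) → (Q → P) → y Decides P → y Decides Q
decides-map f g (holds p) = holds (f p)
decides-map f g (fails ¬p) = fails (¬p ∘ g)

product grow trees range drop nth precedes : Term

-- In the inner fold `input` is the whole state of the outer one, so `input ⨾ left` is the outer
-- item.
product = foldr left empty
  (foldr (input ⨾ right) acc ⟨ ⟨ input ⨾ left , item ⟩ , acc ⟩)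

grow = ⟨ empty , ⟨ self , self ⟩ ⨾ product ⟩

-- The initial `truth` is also the code of the list with the single entry `nil`, that is, of
-- `treesUpTo 0`. Growing twice per step yields height 2k.
trees = foldr self truth (acc ⨾ grow ⨾ grow)

eval-product : ∀ xs ys →
  eval product (encList xs ∙ encList ys) ≡ encList (cartesianProductWith _∙_ xs ys)
eval-product []       ys = refl
eval-product (x ∷ xs) ys = trans
  (cong (λ z → foldrTree (λ y a → (x ∙ y) ∙ a) z (encList ys)) (eval-product xs ys)) (row ys)
  where
  row : ∀ ys′ {zs} → foldrTree (λ y a → (x ∙ y) ∙ a) (encList zs) (encList ys′) ≡
                     encList (map (x ∙_) ys′ ++ zs)
  row []        = refl
  row (y ∷ ys′) = cong ((x ∙ y) ∙_) (row ys′)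

eval-grow : ∀ n → eval grow (encList (treesUpTo n)) ≡ encList (treesUpTo (suc n))
eval-grow n = cong (nil ∙_) (eval-product (treesUpTo n) (treesUpTo n))

foldr-encℕ : ∀ (g : Tree → Tree → Tree) (f : ℕ → Tree) → (∀ n → g nil (f n) ≡ f (suc n)) →
             ∀ n → foldrTree g (f 0) (encℕ n) ≡ f n
foldr-encℕ g f step zero    = refl
foldr-encℕ g f step (suc n) = trans (cong (g nil) (foldr-encℕ g f step n)) (step n)

eval-trees : ∀ n → eval trees (encℕ n) ≡ encList (treesUpTo (n * 2))
eval-trees = foldr-encℕ _ (λ m → encList (treesUpTo (m * 2))) (λ m →
  trans (cong (eval grow) (eval-grow (m * 2))) (eval-grow (suc (m * 2))))

-- The fold carries one number too many, so that the head of the accumulator determines the next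
-- entry; the final `right` removes the surplus n.
range = foldr self truth ⟨ ⟨ empty , acc ⨾ left ⟩ , acc ⟩ ⨾ right

eval-range : ∀ n → eval range (encℕ n) ≡ encList (map encℕ (downFrom n))
eval-range n = cong rightOf (foldr-encℕ _ (λ m → encList (map encℕ (downFrom (suc m)))) (λ m → refl) n)

-- Unary numbers are lists, so cutting b by the length of a compares a and b.
drop = foldr left right (acc ⨾ right)
nth  = drop ⨾ left

spine : Tree → ℕ
spine nil     = 0
spine (_ ∙ r) = suc (spine r)

spine-encℕ : ∀ n → spine (encℕ n) ≡ n
spine-encℕ zero    = refl
spine-encℕ (suc n) = cong suc (spine-encℕ n)

spine-rightOf : ∀ t → spine (rightOf t) ≡ pred (spine t)
spine-rightOf nil     = refl
spine-rightOf (_ ∙ _) = refl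

spine-drop : ∀ a b → spine (eval drop (a ∙ b)) ≡ spine b ∸ spine a
spine-drop nil     b = refl
spine-drop (h ∙ a) b = begin
  spine (rightOf d)        ≡⟨ spine-rightOf d ⟩
  pred (spine d)           ≡⟨ cong pred (spine-drop a b) ⟩
  pred (spine b ∸ spine a) ≡⟨ pred[m∸n]≡m∸[1+n] (spine b) (spine a) ⟩
  spine b ∸ suc (spine a)  ∎
  where
  open ≡-Reasoning
  d = foldrTree (λ _ → rightOf) b a

drop-decides : ∀ a b → eval drop (a ∙ b) Decides spine a < spine b
drop-decides a b with eval drop (a ∙ b) | spine-drop a b
... | nil   | eq = fails λ a<b → m>n⇒m∸n≢0 a<b (sym eq)
... | _ ∙ r | eq = holds (m∸n≢0⇒n<m λ eq′ → 1+n≢0 (trans eq eq′))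

-- The recursion of the fold adds `rightOf` on the outside; moving one application to the inside
-- lets `eval-nth` recurse into the tail.
drop-cons : ∀ n x xs → eval drop (encℕ (suc n) ∙ x ∙ xs) ≡ eval drop (encℕ n ∙ xs)
drop-cons zero    x xs = refl
drop-cons (suc n) x xs = cong rightOf (drop-cons n x xs)

eval-nth : ∀ {n} (f : Fin n → Tree) i → eval nth (encFin i ∙ encList (tabulate f)) ≡ f i
eval-nth f zero    = refl
eval-nth f (suc i) = trans (cong leftOf (drop-cons (toℕ i) (f zero) _)) (eval-nth (f ∘ suc) i)

-- Missing entries read as position 0, so that every tree is an assignment.
position : ∀ {k} → Tree → Fin k → ℕ
position L s = spine (eval nth (encFin s ∙ L))

position-tabulate : ∀ {k n} (f : Fin k → Fin n) s →
  position (encList (tabulate (encFin ∘ f))) s ≡ toℕ (f s)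
position-tabulate f s = trans (cong spine (eval-nth (encFin ∘ f) s)) (spine-encℕ (toℕ (f s)))

precedes = ⟨ ⟨ left ⨾ left , right ⟩ ⨾ nth , ⟨ left ⨾ right , right ⟩ ⨾ nth ⟩ ⨾ drop

precedes-decides : ∀ {k} (s t : Fin k) L →
  eval precedes ((encFin s ∙ encFin t) ∙ L) Decides position L s < position L t
precedes-decides s t L = drop-decides (eval nth (encFin s ∙ L)) (eval nth (encFin t ∙ L))

-- list ∙ environment
every select : Term → Term
every t  = foldr left truth (cond (⟨ item , input ⨾ right ⟩ ⨾ t) acc empty)
select t = foldr left empty (cond (⟨ item , input ⨾ right ⟩ ⨾ t) ⟨ item , acc ⟩ acc)

module _ {A : Set} (enc : A → Tree) {P : A → Set} (t : Term) (e : Tree)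
         (decides : ∀ x → eval t (enc x ∙ e) Decides P x) where

  every-decides : ∀ xs → eval (every t) (encList (map enc xs) ∙ e) Decides All P xs
  every-decides [] = holds []
  every-decides (x ∷ xs) with eval t (enc x ∙ e) | decides x
  ... | _ | holds p = decides-map (p ∷_) All.tail (every-decides xs)
  ... | _ | fails ¬p = fails (¬p ∘ All.head)

  eval-select : ∀ xs → eval (select t) (encList (map enc xs) ∙ e) ≡
                       encList (map enc (filter (λ x → decision (decides x)) xs))
  eval-select [] = refl
  eval-select (x ∷ xs) with eval t (enc x ∙ e) | decides x
  ... | _ | holds p = cong (enc x ∙_) (eval-select xs)
  ... | _ | fails ¬p = eval-select xs

-- The bound on `κ` is uniform in the accumulator, so intermediate results of the fold need not be
-- followed.
foldrCost-bound : ∀ κ g a {b} xs → All (λ x → ∀ acc → κ x acc ≤ b) xs →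
                  foldrCost κ g a (encList xs) ≤ length xs * (37 + b)
foldrCost-bound κ g a []       []           = z≤n
foldrCost-bound κ g a (x ∷ xs) (κ≤b ∷ κs≤b) =
  +-mono-≤ (+-monoʳ-≤ 37 (κ≤b _)) (foldrCost-bound κ g a xs κs≤b)

-- The literals are what `cost` reduces to: 29 is the fixed overhead of the fold, and 50 is 37 per
-- item plus 13 for the `cond` around `t`.
every-cost : ∀ t b e xs → All (λ x → cost t (x ∙ e) ≤ b) xs →
           cost (every t) (encList xs ∙ e) ≤ 29 + length xs * (50 + b)
every-cost t b e xs bs = +-monoʳ-≤ 29
  (foldrCost-bound _ _ _ xs (All.map (λ c≤b _ → +-monoʳ-≤ 13 c≤b) bs))

select-cost : ∀ t b e xs → All (λ x → cost t (x ∙ e) ≤ b) xs →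
              cost (select t) (encList xs ∙ e) ≤ 27 + length xs * (54 + b)
select-cost t b e xs bs = +-monoʳ-≤ 27
  (foldrCost-bound _ _ _ xs (All.map (λ c≤b _ → +-monoʳ-≤ 17 c≤b) bs))

-- Schedules from positions and positions from schedules

AllPairs-lookup : ∀ {A : Set} {R : A → A → Set} {xs} → AllPairs R xs →
                  ∀ {i j} → i <ᶠ j → R (lookup xs i) (lookup xs j)
AllPairs-lookup {xs = _ ∷ _} (r ∷ _)  {zero}  {suc j} _         = All.lookup r (∈-lookup j)
AllPairs-lookup {xs = _ ∷ _} (_ ∷ rs) {suc i} {suc j} (s≤s i<j) = AllPairs-lookup rs i<j

module _ {k n} (W : Schema k n) where
  open Schema W

  Respects : (Fin k → ℕ) → Set
  Respects pos = ∀ s t → T (E s t) → pos s < pos t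

  -- Positions may coincide, but a tie at a constraint would leave open whether its relation must
  -- hold. A constraint with equal source and target is never comparable, just as no schedule
  -- satisfies it.
  Comparable : (Fin k → ℕ) → Constraint k n → Set
  Comparable pos c = pos source < pos target ⊎ pos target < pos source
    where open Constraint c

  -- Steps in equal positions are unrelated, so sorting by position
  -- yields a linear extension.
  module Sorted (pos : Fin k → ℕ) (respects : Respects pos) where

    order : DecTotalOrder _ _ _
    order = On.decTotalOrder ≤-decTotalOrder pos

    open Sort order using (sort; sort-↭; sort-↗)

    sorted : List (Fin k)
    sorted = sort (allFin k)

    length-sorted : length sorted ≡ k
    length-sorted = trans (↭-length (sort-↭ (allFin k))) (length-tabulate id)

    unique : Unique sorted
    unique = Unique-resp-↭ (setoid _) (↭⇒↭ₛ (↭-sym (sort-↭ (allFin k)))) (allFin⁺ k)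

    step : Fin k → Fin k
    step i = lookup sorted (cast (sym length-sorted) i)

    exhaustive : ∀ s → ∃[ i ] step i ≡ s
    exhaustive s = cast length-sorted (index s∈) ,
      trans (cong (lookup sorted) (cast-involutive (sym length-sorted) length-sorted (index s∈)))
            (sym (lookup-index s∈))
      where s∈ = ∈-resp-↭ (↭-sym (sort-↭ (allFin k))) (∈-allFin s)

    step-mono : ∀ i j → toℕ i ≤ toℕ j → pos (step i) ≤ pos (step j)
    step-mono i j i≤j = lookup-mono-≤ (DecTotalOrder.totalOrder order) (sort-↗ (allFin k))
      (subst₂ _≤_ (sym (toℕ-cast _ i)) (sym (toℕ-cast _ j)) i≤j)

    step-distinct : ∀ i j → i <ᶠ j → step i ≢ step j
    step-distinct i j i<j = AllPairs-lookup unique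
      (subst₂ _<_ (sym (toℕ-cast _ i)) (sym (toℕ-cast _ j)) i<j)

    path : ∀ {s t} → s ≼ t → s ≡ t ⊎ pos s < pos t
    path ε = inj₁ refl
    path (e ◅ p) with path p
    ... | inj₁ refl = inj₂ (respects _ _ e)
    ... | inj₂ lt   = inj₂ (<-trans (respects _ _ e) lt)

    schedule : Schedule
    schedule = record
      { step       = step
      ; exhaustive = exhaustive
      ; extension  = extension
      }
      where
      extension : ∀ i j → i <ᶠ j → ¬ (step j ≼ step i)
      extension i j i<j p with path p
      ... | inj₁ eq = step-distinct i j i<j (sym eq)
      ... | inj₂ lt = <⇒≱ lt (step-mono i j (<⇒≤ i<j))

    precedes-schedule : ∀ {s t} → pos s < pos t → Schedule.Precedes schedule s t
    precedes-schedule {s} {t} lt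
      with i , refl ← exhaustive s | j , refl ← exhaustive t with toℕ i <? toℕ j
    ... | yes i<j = i , j , refl , refl , i<j
    ... | no  i≮j = contradiction (step-mono j i (≮⇒≥ i≮j)) (<⇒≱ lt)

  module Positions (σ : Schedule) where
    open Schedule σ

    index-of : Fin k → Fin k
    index-of s = proj₁ (exhaustive s)

    -- Two indices of the same step would violate `extension` through the empty path.
    step-injective : ∀ {i j} → step i ≡ step j → i ≡ j
    step-injective {i} {j} eq with <ᶠ-cmp i j
    ... | tri< i<j _ _ = contradiction (subst (_≼ step i) eq ε) (extension i j i<j)
    ... | tri≈ _ i≡j _ = i≡j
    ... | tri> _ _ j<i = contradiction (subst (_≼ step j) (sym eq) ε) (extension j i j<i)

    index-of-step : ∀ i → index-of (step i) ≡ i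
    index-of-step i = step-injective (proj₂ (exhaustive (step i)))

    index-of-precedes : ∀ {s t} → Precedes s t → index-of s <ᶠ index-of t
    index-of-precedes (i , j , refl , refl , i<j) =
      subst₂ _<ᶠ_ (sym (index-of-step i)) (sym (index-of-step j)) i<j

    index-of-respects : Respects (toℕ ∘ index-of)
    index-of-respects s t e
      with i , refl ← exhaustive s | j , refl ← exhaustive t with <ᶠ-cmp i j
    ... | tri< i<j _ _  = i<j
    ... | tri≈ _ refl _ = contradiction [ e ] (acyclic _)
    ... | tri> _ _ j<i  = contradiction (e ◅ ε) (extension j i j<i)

-- Admissible positions

encBool-decides : ∀ b → encBool b Decides T b
encBool-decides true  = holds tt
encBool-decides false = fails id

decides-→ : ∀ {y z P Q} → y Decides P → z Decides Q → branch y z (nil ∙ nil) Decides (P → Q)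
decides-→ (holds p) z = decides-map (λ q _ → q) (λ f → f p) z
decides-→ (fails ¬p) _ = holds λ p → contradiction p ¬p

decides-× : ∀ {y z P Q} → y Decides P → z Decides Q → branch y z nil Decides (P × Q)
decides-× (holds p) z = decides-map (p ,_) proj₂ z
decides-× (fails ¬p) _ = fails (¬p ∘ proj₁)

decides-⊎ : ∀ {y z P Q} → y Decides P → z Decides Q → branch y (nil ∙ nil) z Decides (P ⊎ Q)
decides-⊎ (holds p) _ = holds (inj₁ p)
decides-⊎ (fails ¬p) z = decides-map inj₂ [ (λ p → contradiction p ¬p) , id ]′ z

-- Descending, to match the order in which `range` lists the numbers.
fins : ∀ k → List (Fin k)
fins zero    = []
fins (suc k) = fromℕ k ∷ map inject₁ (fins k)

∈-fins : ∀ {k} (i : Fin k) → i ∈ fins k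
∈-fins {suc k} i with view i
... | ‵fromℕ     = here refl
... | ‵inject₁ j = there (∈-map⁺ inject₁ (∈-fins j))

map-encFin-fins : ∀ k → map encFin (fins k) ≡ map encℕ (downFrom k)
map-encFin-fins zero    = refl
map-encFin-fins (suc k) = cong₂ _∷_ (cong encℕ (toℕ-fromℕ k))
  (trans (sym (map-∘ (fins k)))
  (trans (map-cong (cong encℕ ∘ toℕ-inject₁) (fins k)) (map-encFin-fins k)))

k*2≤ : ∀ k → k * 2 ≤ k + (k + 1)
k*2≤ k = subst (k * 2 ≤_) (lemma k) (n≤1+n (k * 2))
  where
  lemma : ∀ k → 1 + k * 2 ≡ k + (k + 1)
  lemma = solve-∀

edge edgeRespected respectsFrom respects distinct comparable admissible restrict candidates : Term

-- (number of steps ∙ edges) ∙ positions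
respects = ⟨ left ⨾ left ⨾ range , self ⟩ ⨾ every respectsFrom
respectsFrom = ⟨ right ⨾ left ⨾ left ⨾ range , self ⟩ ⨾ every edgeRespected
edgeRespected = cond edge (⟨ ⟨ right ⨾ left , left ⟩ , right ⨾ right ⨾ right ⟩ ⨾ precedes) truth
edge = ⟨ left , ⟨ right ⨾ left , right ⨾ right ⨾ left ⨾ right ⟩ ⨾ nth ⟩ ⨾ nth

-- (source ∙ target) ∙ positions
distinct = cond precedes truth (⟨ ⟨ left ⨾ right , left ⨾ left ⟩ , right ⟩ ⨾ precedes)

-- constraint ∙ positions
comparable = ⟨ left ⨾ right , right ⟩ ⨾ distinct

-- positions ∙ schema
admissible = cond
  (⟨ ⟨ right ⨾ left , right ⨾ right ⨾ left ⟩ , left ⟩ ⨾ respects)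
  (⟨ right ⨾ right ⨾ right ⨾ right ⨾ right , left ⟩ ⨾ every comparable)
  empty
restrict =
  ⟨ right ⨾ left , ⟨ right ⨾ right ⨾ left , ⟨ right ⨾ right ⨾ right ⨾ left ,
  ⟨ right ⨾ right ⨾ right ⨾ right ⨾ left ,
  ⟨ right ⨾ right ⨾ right ⨾ right ⨾ right , left ⟩ ⨾
  select (⟨ left ⨾ right , right ⟩ ⨾ precedes) ⟩ ⟩ ⟩ ⟩

candidates = ⟨ left ⨾ trees , self ⟩ ⨾ select admissible

seq-cost : ∀ s t x {b} → cost t (eval s x) ≤ b → cost (s ⨾ t) x ≤ suc (cost s x + b)
seq-cost s t x t≤b = s≤s (+-monoʳ-≤ (cost s x) t≤b)

-- Here `k + (k + 1)` bounds the height of the edge matrix and also that of an assignment, by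
-- `k*2≤`; the summand 3 makes room for the pairing of inputs.
heightBound : ℕ → ℕ
heightBound k = 3 + (k + (k + 1))

bound : ℕ → Term → ℕ
bound k t = boundUpTo (cost t) (heightBound k)

module _ {k n} (W : Schema k n) where
  open Schema W

  Kept : Tree → Constraint k n → Set
  Kept L c = position L source < position L target
    where open Constraint c

  kept-decides : ∀ L c →
    eval precedes ((encFin (Constraint.source c) ∙ encFin (Constraint.target c)) ∙ L) Decides Kept L c
  kept-decides L c = precedes-decides source target L
    where open Constraint c

  kept? : ∀ L c → Dec (Kept L c)
  kept? L c = decision (kept-decides L c)

  -- At admissible positions every dropped constraint has its target placed first, so it holds for
  -- every plan.
  restriction : Tree → Schema k n
  restriction L = record
    { E = E ; A = A ; C = filter (kept? L) C ; acyclic = acyclic ; authorized = authorized }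

  eval-restrict : ∀ L → eval restrict (L ∙ encSchema W) ≡ encSchema (restriction L)
  eval-restrict L = cong (λ c → encℕ k ∙ encMatrix E ∙ encℕ n ∙ encMatrix A ∙ c)
    (eval-select encConstraint (⟨ left ⨾ right , right ⟩ ⨾ precedes) L (kept-decides L) C)

  edge-decides : ∀ L s t →
    eval edge (encFin t ∙ encFin s ∙ (encℕ k ∙ encMatrix E) ∙ L) Decides T (E s t)
  edge-decides L s t = subst (_Decides T (E s t))
    (sym (trans (cong (λ row → eval nth (encFin t ∙ row)) (eval-nth _ s)) (eval-nth _ t)))
    (encBool-decides (E s t))

  all-fins-decides : ∀ t e {P : Fin k → Set} →
    (∀ i → eval t (encFin i ∙ e) Decides P i) →
    eval (every t) (eval range (encℕ k) ∙ e) Decides (∀ i → P i)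
  all-fins-decides t e {P} d = subst (λ r → eval (every t) (r ∙ e) Decides (∀ i → P i))
    (sym (trans (eval-range k) (cong encList (sym (map-encFin-fins k)))))
    (decides-map (λ ps i → All.lookup ps (∈-fins i)) (λ p → All.tabulate λ _ → p _)
      (every-decides encFin t e d (fins k)))

  respects-decides : ∀ L →
    eval respects ((encℕ k ∙ encMatrix E) ∙ L) Decides Respects W (position L)
  respects-decides L =
    all-fins-decides respectsFrom ((encℕ k ∙ encMatrix E) ∙ L) λ s →
    all-fins-decides edgeRespected (encFin s ∙ (encℕ k ∙ encMatrix E) ∙ L) λ t →
    decides-→ (edge-decides L s t) (precedes-decides s t L)

  comparable-decides : ∀ L c →
    eval comparable (encConstraint c ∙ L) Decides Comparable W (position L) c
  comparable-decides L c =
    decides-⊎ (precedes-decides source target L) (precedes-decides target source L)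
    where open Constraint c

  Admissible : Tree → Set
  Admissible L = Respects W (position L) × All (Comparable W (position L)) C

  admissible-decides : ∀ L → eval admissible (L ∙ encSchema W) Decides Admissible L
  admissible-decides L =
    decides-× (respects-decides L)
              (every-decides encConstraint comparable L (comparable-decides L) C)

  admissible? : ∀ L → Dec (Admissible L)
  admissible? L = decision (admissible-decides L)

  admissibles : List Tree
  admissibles = filter admissible? (treesUpTo (k * 2))

  eval-candidates : eval candidates (encSchema W) ≡ encList admissibles
  eval-candidates = begin
    eval (select admissible) (eval trees (encℕ k) ∙ encSchema W)
      ≡⟨ cong (λ Ls → eval (select admissible) (Ls ∙ encSchema W)) (eval-trees k) ⟩
    eval (select admissible) (encList (treesUpTo (k * 2)) ∙ encSchema W)
      ≡⟨ cong (λ Ls → eval (select admissible) (encList Ls ∙ encSchema W))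
              (map-id (treesUpTo (k * 2))) ⟨
    eval (select admissible) (encList (map id (treesUpTo (k * 2))) ∙ encSchema W)
      ≡⟨ eval-select id admissible (encSchema W) admissible-decides (treesUpTo (k * 2)) ⟩
    encList (map id admissibles)
      ≡⟨ cong encList (map-id admissibles) ⟩
    encList admissibles ∎
    where open ≡-Reasoning

  -- Costs of testing positions and restricting the schema

  height-respects : ∀ L → height L ≤ k * 2 →
    height ((encℕ k ∙ encMatrix E) ∙ L) ≤ heightBound k
  height-respects L h = s≤s (⊔-lub
    (s≤s (⊔-lub (≤-trans (≤-reflexive (height-encℕ k)) (≤-trans (m≤m+n k (k + 1)) (n≤1+n _)))
                (≤-trans (height-encMatrix E) (n≤1+n _))))
    (≤-trans h (≤-trans (k*2≤ k) (m≤n+m _ 2))))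

  height-pair : ∀ (s t : Fin k) L → height L ≤ k * 2 →
    height ((encFin s ∙ encFin t) ∙ L) ≤ heightBound k
  height-pair s t L h = s≤s (⊔-lub
    (s≤s (⊔-lub (fin s) (fin t)))
    (≤-trans h (≤-trans (k*2≤ k) (m≤n+m _ 2))))
    where
    fin : ∀ (i : Fin k) → height (encFin i) ≤ suc (k + (k + 1))
    fin i = ≤-trans (height-encFin i) (≤-trans (m≤m+n k (k + 1)) (n≤1+n _))

  constraintCount : ℕ
  constraintCount = length (map encConstraint C)

  -- The relation matrix grows with the number of users, so it is projected away before `t` runs;
  -- what remains has height bounded in k.
  constraint-cost : ∀ t L → height L ≤ k * 2 →
    All (λ c → cost (⟨ left ⨾ right , right ⟩ ⨾ t) (c ∙ L) ≤ 6 + bound k t) (map encConstraint C)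
  constraint-cost t L h = All.map⁺ (All.universal (λ c →
    seq-cost ⟨ left ⨾ right , right ⟩ t (encConstraint c ∙ L)
      (≤-boundUpTo (cost t) _ (height-pair (Constraint.source c) (Constraint.target c) L h))) C)

  -- Only the number of steps, the edges and the positions reach `respects`, so the sole dependence
  -- on the rest of the instance is through the number of constraints.
  admissible-cost : ∀ L → height L ≤ k * 2 → cost admissible (L ∙ encSchema W) ≤
    13 + (29 + constraintCount * (56 + bound k distinct)) + 1 + (12 + bound k respects)
  admissible-cost L h = +-mono-≤ (+-monoˡ-≤ 1 (+-monoʳ-≤ 13
      (every-cost comparable (6 + bound k distinct) L (map encConstraint C)
        (constraint-cost distinct L h))))
    (+-monoʳ-≤ 12 (≤-boundUpTo (cost respects) ((encℕ k ∙ encMatrix E) ∙ L) (height-respects L h)))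

  restrict-cost : ∀ L → height L ≤ k * 2 → cost restrict (L ∙ encSchema W) ≤
    40 + (27 + constraintCount * (60 + bound k precedes))
  restrict-cost L h = +-monoʳ-≤ 40
    (select-cost (⟨ left ⨾ right , right ⟩ ⨾ precedes) (6 + bound k precedes) L (map encConstraint C)
      (constraint-cost precedes L h))

-- Running time

length≤size : ∀ xs → length xs ≤ size (encList xs)
length≤size []       = z≤n
length≤size (x ∷ xs) = s≤s (≤-trans (length≤size xs) (m≤n+m _ (size x)))

size-filter : ∀ {A : Set} {P : A → Set} (enc : A → Tree) (P? : Decidable P) xs →
              size (encList (map enc (filter P? xs))) ≤ size (encList (map enc xs))
size-filter enc P? [] = ≤-refl
size-filter enc P? (x ∷ xs) with P? x
... | yes _ = s≤s (+-monoʳ-≤ (size (enc x)) (size-filter enc P? xs))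
... | no  _ = ≤-trans (size-filter enc P? xs) (≤-trans (m≤n+m _ (size (enc x))) (n≤1+n _))

1≤size : ∀ x → 1 ≤ size x
1≤size nil     = s≤s z≤n
1≤size (_ ∙ _) = s≤s z≤n

size-right : ∀ x y → size y ≤ size (x ∙ y)
size-right x y = ≤-trans (m≤n+m (size y) (size x)) (n≤1+n _)

size-mono : ∀ x {m n} → m ≤ n → suc (size x + m) ≤ suc (size x + n)
size-mono x m≤n = s≤s (+-monoʳ-≤ (size x) m≤n)

module _ {k n} (W : Schema k n) where
  open Schema W

  -- This bounds the time of each WSP call in terms of the size of the given OWSP instance.
  size-restriction : ∀ L → size (encSchema (restriction W L)) ≤ size (encSchema W)
  size-restriction L = size-mono (encℕ k) (size-mono (encMatrix E) (size-mono (encℕ n)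
    (size-mono (encMatrix A) (size-filter encConstraint (kept? W L) C))))

  constraintCount≤size : constraintCount W ≤ size (encSchema W)
  constraintCount≤size = ≤-trans (length≤size (map encConstraint C))
    (≤-trans (size-right (encMatrix A) c₀)
    (≤-trans (size-right (encℕ n) c₁)
    (≤-trans (size-right (encMatrix E) c₂)
             (size-right (encℕ k) c₃))))
    where
    c₀ = encList (map encConstraint C)
    c₁ = encMatrix A ∙ c₀
    c₂ = encℕ n ∙ c₁
    c₃ = encMatrix E ∙ c₂

-- b₀ is the cost of listing the m trees; b₁, b₂ and b₃ bound one run of
-- distinct, respects and precedes.  The total cost is affine in the number l
-- of constraints and in s = N ^ d, so it grows at most by the factor z when
-- z bounds both.
module Cost (b₀ m b₁ b₂ b₃ f : ℕ) where

  candidatesCost restrictCost : ℕ → ℕ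
  candidatesCost l = suc (suc (suc (1 + b₀) + 1) +
    (27 + m * (54 + (13 + (29 + l * (56 + b₁)) + 1 + (12 + b₂)))))
  restrictCost l = 40 + (27 + l * (60 + b₃))

  itemCost totalCost : ℕ → ℕ → ℕ
  itemCost  l s = 14 + (restrictCost l + f * s)
  totalCost l s = suc (suc (candidatesCost l + 3) + (21 + m * (37 + itemCost l s)))

  module _ {z l s : ℕ} (1≤z : 1 ≤ z) (l≤z : l ≤ z) (s≤z : s ≤ z) where

    infix  4 _≼_
    infixr 6 _⊕_ _⊗_

    -- Being closed under sums and constant multiples, the relation lets the bounds below follow the
    -- cost expressions summand by summand.
    _≼_ : ℕ → ℕ → Set
    x ≼ a = x ≤ z * a

    const : ∀ c → c ≼ c
    const c = ≤-trans (≤-reflexive (sym (*-identityˡ c))) (*-monoˡ-≤ c 1≤z)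

    _⊕_ : ∀ {x y a b} → x ≼ a → y ≼ b → x + y ≼ a + b
    _⊕_ {a = a} {b} x≼a y≼b = ≤-trans (+-mono-≤ x≼a y≼b) (≤-reflexive (sym (*-distribˡ-+ z a b)))

    _⊗_ : ∀ c {x a} → x ≼ a → c * x ≼ c * a
    _⊗_ c {x} {a} x≼a = begin
      c * x       ≤⟨ *-monoʳ-≤ c x≼a ⟩
      c * (z * a) ≡⟨ *-assoc c z a ⟨
      c * z * a   ≡⟨ cong (_* a) (*-comm c z) ⟩
      z * c * a   ≡⟨ *-assoc z c a ⟩
      z * (c * a) ∎
      where open ≤-Reasoning

    -- The right side stays `1 * c`, the form that the cost expressions take at `l = 1`.
    times : ∀ {x} → x ≤ z → ∀ c → x * c ≼ 1 * c
    times x≤z c = ≤-trans (*-monoˡ-≤ c x≤z) (≤-reflexive (cong (z *_) (sym (*-identityˡ c))))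

    candidates≼ : candidatesCost l ≼ candidatesCost 1
    candidates≼ = const (suc (suc (suc (1 + b₀) + 1))) ⊕ const 27 ⊕
      m ⊗ (const 54 ⊕ (const 13 ⊕ (const 29 ⊕ times l≤z (56 + b₁)) ⊕ const 1) ⊕ const (12 + b₂))

    restrict≼ : restrictCost l ≼ restrictCost 1
    restrict≼ = const 40 ⊕ const 27 ⊕ times l≤z (60 + b₃)

    item≼ : itemCost l s ≼ itemCost 1 1
    item≼ = const 14 ⊕ restrict≼ ⊕ f ⊗ ≤-trans s≤z (≤-reflexive (sym (*-identityʳ z)))

    total≼ : totalCost l s ≼ totalCost 1 1
    total≼ = const 1 ⊕ (const 1 ⊕ candidates≼ ⊕ const 3) ⊕ const 21 ⊕ m ⊗ (const 37 ⊕ item≼)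

-- The reduction

-- The answers are encoded plans, so a positive one is replaced by `nil ∙ nil`, the output that
-- `OWSP₁` accepts as yes.
foldr-any : ∀ {P : Tree → Set} (y : Tree → Tree) → (∀ x → y x Decides P x) → ∀ xs →
  (Any P xs × foldrTree (λ x a → branch (y x) (nil ∙ nil) a) nil (encList xs) ≡ encBool true) ⊎
  (¬ Any P xs × foldrTree (λ x a → branch (y x) (nil ∙ nil) a) nil (encList xs) ≡ encBool false)
foldr-any y d [] = inj₂ ((λ ()) , refl)
foldr-any y d (x ∷ xs) with y x | d x
... | _ | holds p = inj₁ (here p , refl)
... | _ | fails ¬p with foldr-any y d xs
...   | inj₁ (any , eq)  = inj₁ (there any , eq)
...   | inj₂ (¬any , eq) = inj₂ ((λ { (here p) → ¬p p ; (there any) → ¬any any }) , eq)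

module _ {t} {𝓡 : Relations t} where

  wspInstance : OWSPInstance 𝓡 → Tree → WSPInstance 𝓡
  wspInstance I L = record
    { steps      = steps
    ; users      = users
    ; schema     = restriction schema L
    ; restricted = proj₁ restricted , proj₁ (proj₂ restricted) ,
                   All.filter⁺ (kept? schema L) (proj₂ (proj₂ restricted))
    }
    where open OWSPInstance I

  module _ (I : OWSPInstance 𝓡) where
    open OWSPInstance I

    Solvable : Tree → Set
    Solvable L = ∃[ π ] WSPInstance.Solution (wspInstance I L) π

    -- Sorting turns strict inequality of positions into precedence: kept constraints hold by the
    -- WSP solution, the others because their target comes first.
    solution-from : ∀ {L} → Admissible schema L → Solvable L → ∃[ σ ] ∃[ π ] Solution σ π
    solution-from {L} (respects , comparable) (π , auth , sat) = schedule , π , auth ,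
      All.tabulate λ {c} c∈ → satisfied c c∈ (All.lookup comparable c∈)
      where
      open Sorted schema (position L) respects
      satisfied : ∀ c → c ∈ C → Comparable schema (position L) c → Satisfies schedule π c
      satisfied c c∈ (inj₁ s<t) = inj₁ (precedes-schedule s<t ,
        All.lookup sat (∈-filter⁺ (kept? schema L) c∈ s<t))
      satisfied c c∈ (inj₂ t<s) = inj₂ (precedes-schedule t<s)

    -- The witness `L` lists the schedule index of each step. Its length is k and its entries have
    -- height at most k, so it is among the enumerated trees.
    solution-to : ∀ {σ π} → Solution σ π → Any Solvable (admissibles schema)
    solution-to {σ} {π} (auth , sat) = lose
      (∈-filter⁺ (admissible? schema) (∈-treesUpTo L height-L)
        (respects-L , All.map (λ {c} → comparable-L c) sat))
      (π , auth , All.tabulate λ {c} c∈ → satisfied c c∈)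
      where
      open Positions schema σ
      open Schedule σ

      L : Tree
      L = encList (tabulate (encFin ∘ index-of))

      height-L : height L ≤ steps * 2
      height-L = ≤-trans (height-tabulate (encFin ∘ index-of) (height-encFin ∘ index-of))
        (≤-reflexive (trans (cong (steps +_) (sym (+-identityʳ steps))) (*-comm 2 steps)))

      position-L : ∀ s → position L s ≡ toℕ (index-of s)
      position-L = position-tabulate index-of

      to : ∀ {s u} → toℕ (index-of s) < toℕ (index-of u) → position L s < position L u
      to = subst₂ _<_ (sym (position-L _)) (sym (position-L _))

      from : ∀ {s u} → position L s < position L u → toℕ (index-of s) < toℕ (index-of u)
      from = subst₂ _<_ (position-L _) (position-L _)

      respects-L : Respects schema (position L)
      respects-L s u e = to (index-of-respects s u e)

      comparable-L : ∀ c → Satisfies σ π c → Comparable schema (position L) c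
      comparable-L c (inj₁ (s<t , _)) = inj₁ (to (index-of-precedes s<t))
      comparable-L c (inj₂ t<s)       = inj₂ (to (index-of-precedes t<s))

      satisfied : ∀ c → c ∈ filter (kept? schema L) C → WSPInstance.Satisfies (wspInstance I L) π c
      satisfied c c∈ with c∈C , s<t ← ∈-filter⁻ (kept? schema L) {xs = C} c∈ | All.lookup sat c∈C
      ... | inj₁ (_ , ρ) = ρ
      -- A kept constraint cannot hold by reversed precedence, since precedence is asymmetric.
      ... | inj₂ t<s     = contradiction (from s<t) (<-asym (index-of-precedes t<s))

  -- The solver, its running time and its correctness

  module Reduction (p : Program) (f : ℕ → ℕ) (d : ℕ)
    (solve : (I : WSPInstance 𝓡) → ∃[ y ] ∃[ c ]
      (p ⊢ encSchema (WSPInstance.schema I) ⇓ y [ c ])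
      × c ≤ f (WSPInstance.steps I) * size (encSchema (WSPInstance.schema I)) ^ d
      × ParamProblem.Correct (WSP₁ 𝓡) I y) where

    -- As `p` is an arbitrary program and not a term, this fold is built with `foldrProgram`
    -- directly. On a negative answer `right ⨾ right` passes on the verdict so far.
    solveRestriction solver : Program
    solveRestriction = cond (⟨ left , right ⨾ left ⟩ ⨾ compile restrict ⨾ p)
      ⟨ empty , empty ⟩ (right ⨾ right)
    solver = ⟨ compile candidates , ⟨ self , empty ⟩ ⟩ ⨾ foldrProgram solveRestriction

    module C (k : ℕ) = Cost (cost trees (encℕ k)) (length (treesUpTo (k * 2)))
      (bound k distinct) (bound k respects) (bound k precedes) (f k)

    module _ (I : OWSPInstance 𝓡) where
      open OWSPInstance I

      x : Tree
      x = encSchema schema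

      answer : Tree → Tree
      answer L = proj₁ (solve (wspInstance I L))

      answer-decides : ∀ L → answer L Decides Solvable I L
      answer-decides L with solve (wspInstance I L)
      ... | _ , _ , _ , _ , inj₁ (π , sol , refl) = holds (π , sol)
      ... | _ , _ , _ , _ , inj₂ (¬sol , refl)    = fails ¬sol

      answer-runs : ∀ L → p ⊢ eval restrict (L ∙ x) ⇓ answer L ≤[ f steps * size x ^ d ]
      answer-runs L with solve (wspInstance I L)
      ... | y , c , run , c≤ , _ = c , subst (λ i → p ⊢ i ⇓ y [ c ]) (sym (eval-restrict schema L)) run ,
        ≤-trans c≤ (*-monoʳ-≤ (f steps) (^-monoˡ-≤ d (size-restriction schema L)))

      stepCost : Tree → Tree → ℕ
      stepCost L _ = 14 + (cost restrict (L ∙ x) + f steps * size x ^ d)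

      verdict : Tree → Tree → Tree
      verdict L acc = branch (answer L) (nil ∙ nil) acc

      solveRestriction-runs : ∀ L acc → solveRestriction ⊢ L ∙ x ∙ acc
        ⇓ verdict L acc ≤[ stepCost L acc ]
      solveRestriction-runs L acc = cond-runs
        (seq-runs (pair-runs (_ , ⇓-left , ≤-refl) (_ , ⇓-seq ⇓-right ⇓-left , ≤-refl))
          (seq-runs (compile-runs restrict (L ∙ x)) (answer-runs L)))
        (_ , ⇓-pair ⇓-empty ⇓-empty , ≤-refl)
        (_ , ⇓-seq ⇓-right ⇓-right , ≤-refl)

      solver-runs : solver ⊢ x ⇓ foldrTree verdict nil (encList (admissibles schema))
        ≤[ suc (suc (cost candidates x + 3) +
                (21 + foldrCost stepCost verdict nil (encList (admissibles schema)))) ]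
      solver-runs = subst (λ l → solver ⊢ x ⇓ foldrTree verdict nil l
          ≤[ suc (suc (cost candidates x + 3) + (21 + foldrCost stepCost verdict nil l)) ])
        (eval-candidates schema)
        (seq-runs (pair-runs (compile-runs candidates x) (_ , ⇓-pair ⇓-self ⇓-empty , ≤-refl))
          (foldrProgram-runs solveRestriction-runs (eval candidates x) nil))

      open C steps

      trees≤ : All (λ L → height L ≤ steps * 2) (treesUpTo (steps * 2))
      trees≤ = All.tabulate (∈-treesUpTo⁻ (steps * 2))

      candidates-cost : cost candidates x ≤ candidatesCost (constraintCount schema)
      candidates-cost = +-monoʳ-≤ (suc (suc (suc (1 + cost trees (encℕ steps)) + 1))) (subst
        (λ l → cost (select admissible) (l ∙ x) ≤
          27 + length (treesUpTo (steps * 2)) * (54 + admissibleBound))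
        (sym (eval-trees steps))
        (select-cost admissible admissibleBound x (treesUpTo (steps * 2))
          (All.map (λ {L} → admissible-cost schema L) trees≤)))
        where
        admissibleBound = 13 + (29 + constraintCount schema * (56 + bound steps distinct)) + 1
          + (12 + bound steps respects)

      verdicts-cost : foldrCost stepCost verdict nil (encList (admissibles schema)) ≤
        length (treesUpTo (steps * 2)) * (37 + itemCost (constraintCount schema) (size x ^ d))
      verdicts-cost = ≤-trans
        (foldrCost-bound stepCost verdict nil (admissibles schema)
          (All.filter⁺ (admissible? schema) (All.map (λ {L} h _ → +-monoʳ-≤ 14
            (+-monoˡ-≤ (f steps * size x ^ d) (restrict-cost schema L h))) trees≤)))
        -- The number of WSP calls is at most the number of all enumerated trees, which depends on k
        -- alone.
        (*-monoˡ-≤ (37 + itemCost (constraintCount schema) (size x ^ d))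
          (length-filter (admissible? schema) (treesUpTo (steps * 2))))

      solver-cost : suc (suc (cost candidates x + 3) +
          (21 + foldrCost stepCost verdict nil (encList (admissibles schema))))
        ≤ totalCost 1 1 * size x ^ suc d
      solver-cost = begin
        suc (suc (cost candidates x + 3) +
          (21 + foldrCost stepCost verdict nil (encList (admissibles schema))))
          ≤⟨ s≤s (+-mono-≤ (s≤s (+-monoˡ-≤ 3 candidates-cost)) (+-monoʳ-≤ 21 verdicts-cost)) ⟩
        totalCost (constraintCount schema) (size x ^ d)
          -- The factor `z` is N times N ^ d, which dominates both the number of constraints and N ^
          -- d.
          ≤⟨ total≼ (*-mono-≤ 1≤x 1≤xᵈ)
               (≤-trans (constraintCount≤size schema) (m≤m*n (size x) (size x ^ d) {{>-nonZero 1≤xᵈ}}))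
               (m≤n*m (size x ^ d) (size x) {{>-nonZero 1≤x}}) ⟩
        size x ^ suc d * totalCost 1 1
          ≡⟨ *-comm (size x ^ suc d) (totalCost 1 1) ⟩
        totalCost 1 1 * size x ^ suc d ∎
        where
        open ≤-Reasoning
        1≤x : 1 ≤ size x
        1≤x = 1≤size x
        1≤xᵈ : 1 ≤ size x ^ d
        1≤xᵈ = m^n>0 (size x) {{>-nonZero 1≤x}} d

      verdict-correct :
        ParamProblem.Correct (OWSP₁ 𝓡) I (foldrTree verdict nil (encList (admissibles schema)))
      verdict-correct with foldr-any answer answer-decides (admissibles schema)
      ... | inj₁ (any , eq) with L , L∈ , sol ← find any =
        inj₁ (solution-from I
                (proj₂ (∈-filter⁻ (admissible? schema) {xs = treesUpTo (steps * 2)} L∈)) sol , eq)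
      ... | inj₂ (¬any , eq) = inj₂ ((λ { (σ , π , sol) → ¬any (solution-to I {σ} {π} sol) }) , eq)

proposition14 : (t : ℕ) (𝓡 : Relations t) → FPT (WSP₁ 𝓡) → FPT (OWSP₁ 𝓡)
proposition14 t 𝓡 (p , f , d , solve) =
  -- The exponent rises by one to pay for the loop over the constraints even when `d` is 0.
  solver , (λ k → C.totalCost k 1 1) , suc d , λ I →
    let c , run , c≤ = solver-runs I
    in _ , c , run , ≤-trans c≤ (solver-cost I) , verdict-correct I
  where open Reduction p f d solve
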